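{- Let $u$ be a word of length $n$. Consider the following procedure: compute the period array $\mathsf{P}[1..n]$ of $u$ and the cover array $\mathsf{C}[1..n]$ of $u$; set $\mathsf{R}[i]:=0$ for all $0\le i\le n$ and then, for $i=1,\dots,n$ in increasing order, set $\mathsf{R}[\mathsf{C}[i]]:=i$; set $ls:=0$; for $i=1,\dots,n$: while $\mathsf{R}[ls]<\mathsf{P}[i]$ increase $ls$ by one, then output $\mathsf{LSeed}[i]:=ls$. This procedure runs in linear time, i.e. $O(n)$.
   Context: $u[1..i]$ is the prefix of length $i$. For a nonempty word $x$, $\mathrm{per}(x)$ is the smallest positive integer $p$ with $x_j=x_{j+p}$ for all $1\le j\le|x|-p$; the period array is $\mathsf{P}[i]=\mathrm{per}(u[1..i])$. A word $s$ covers $w$ if every position of $w$ lies in some occurrence of $s$ in $w$; $\mathrm{cover}(x)$ is the length of the shortest word covering $x$, and the cover array is $\mathsf{C}[i]=\mathrm{cover}(u[1..i])$. (The values $\mathsf{LSeed}[i]$ produced are the lengths of the shortest left seeds of $u[1..i]$.) -}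

module Defs where

open import Data.Bool.Base using (Bool; true; false; not; _∧_; if_then_else_)
open import Data.List.Base using (List; []; _++_; length; head; take; drop)
open import Data.Maybe.Base using (Maybe; just; nothing)
open import Data.Nat.Base using (ℕ; zero; suc; _+_; _*_; _∸_; _≤_; _<_; _<ᵇ_; _≡ᵇ_)
open import Data.Product.Base using (_×_; ∃-syntax; ∃₂)
open import Relation.Binary.Definitions using (DecidableEquality)
open import Relation.Binary.PropositionalEquality.Core using (_≡_)
open import Relation.Nullary.Decidable.Core using (does)

------------------------------------------------------------------------
-- Words

-- Positions are numbered from 1; `nothing` outside 1..|x|.
letter : ∀ {A : Set} → List A → ℕ → Maybe A
letter x zero    = nothing
letter x (suc j) = head (drop j x)

IsLeast : (ℕ → Set) → ℕ → Set
IsLeast Q m = Q m × (∀ k → Q k → m ≤ k)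

HasPeriod : ∀ {A : Set} → List A → ℕ → Set
HasPeriod x p =
  1 ≤ p × (∀ j → 1 ≤ j → j ≤ length x ∸ p → letter x j ≡ letter x (j + p))

IsPer : ∀ {A : Set} → List A → ℕ → Set
IsPer x = IsLeast (HasPeriod x)

Covers : ∀ {A : Set} → List A → List A → Set
Covers s w = ∀ j → 1 ≤ j → j ≤ length w →
  ∃₂ λ x y → w ≡ x ++ s ++ y × length x < j × j ≤ length x + length s

IsCover : ∀ {A : Set} → List A → ℕ → Set
IsCover x = IsLeast (λ ℓ → ∃[ s ] (length s ≡ ℓ × Covers s x))

IsPeriodArray : ∀ {A : Set} → List A → (ℕ → ℕ) → Set
IsPeriodArray u P = ∀ i → 1 ≤ i → i ≤ length u → IsPer (take i u) (P i)

IsCoverArray : ∀ {A : Set} → List A → (ℕ → ℕ) → Set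
IsCoverArray u C = ∀ i → 1 ≤ i → i ≤ length u → IsCover (take i u) (C i)

------------------------------------------------------------------------
-- A unit-cost random access machine
--
-- The input is a read-only word, accessible only through its length and
-- through equality tests between its letters.  The only arithmetic is
-- successor and truncated subtraction, so after t steps no number exceeds by
-- more than t the largest of |u|, the program's literals and the numbers
-- initially stored: unit cost cannot be exploited through huge numbers.

Var Arr : Set
Var = ℕ
Arr = ℕ

infixl 8 _⊝_
infix  9 _[_]
infix  7 _≺_ _≟u_
infixr 6 _∧′_

data Expr : Set where
  lit  : ℕ → Expr
  var  : Var → Expr
  len  : Expr
  _[_] : Arr → Expr → Expr
  suc′ : Expr → Expr
  _⊝_  : Expr → Expr → Expr

-- e ≟u f tests whether the letters of the input at positions e and f agree
-- (it fails when one of the positions is outside the input).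
data Test : Set where
  _≺_ _≟u_ : Expr → Expr → Test
  not′     : Test → Test
  _∧′_     : Test → Test → Test

infix  5 _≔_ _[_]≔_
infixr 4 _︔_

data Cmd : Set where
  skip          : Cmd
  _≔_           : Var → Expr → Cmd
  _[_]≔_        : Arr → Expr → Expr → Cmd
  _︔_           : Cmd → Cmd → Cmd
  if′_then_else_ : Test → Cmd → Cmd → Cmd
  while_loop_   : Test → Cmd → Cmd

record Store : Set where
  constructor store
  field
    scalars : Var → ℕ
    arrays  : Arr → ℕ → ℕ

open Store public

_[_↦_] : ∀ {B : Set} → (ℕ → B) → ℕ → B → ℕ → B
(f [ k ↦ b ]) m = if m ≡ᵇ k then b else f m

setVar : Store → Var → ℕ → Store
setVar (store s a) x v = store (s [ x ↦ v ]) a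

setArr : Store → Arr → ℕ → ℕ → Store
setArr (store s a) X k v = store s (a [ X ↦ a X [ k ↦ v ] ])

costE : Expr → ℕ
costE (lit _)   = 1
costE (var _)   = 1
costE len       = 1
costE (_ [ e ]) = 1 + costE e
costE (suc′ e)  = 1 + costE e
costE (e ⊝ f)   = 1 + costE e + costE f

costT : Test → ℕ
costT (e ≺ f)  = 1 + costE e + costE f
costT (e ≟u f) = 1 + costE e + costE f
costT (not′ b) = 1 + costT b
costT (b ∧′ c) = 1 + costT b + costT c

module Semantics {A : Set} (_≟_ : DecidableEquality A) (u : List A) where

  sameLetter : Maybe A → Maybe A → Bool
  sameLetter (just a) (just b) = does (a ≟ b)
  sameLetter _        _        = false

  evalE : Store → Expr → ℕ
  evalE σ (lit k)   = k
  evalE σ (var x)   = scalars σ x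
  evalE σ len       = length u
  evalE σ (X [ e ]) = arrays σ X (evalE σ e)
  evalE σ (suc′ e)  = suc (evalE σ e)
  evalE σ (e ⊝ f)   = evalE σ e ∸ evalE σ f

  evalT : Store → Test → Bool
  evalT σ (e ≺ f)  = evalE σ e <ᵇ evalE σ f
  evalT σ (e ≟u f) = sameLetter (letter u (evalE σ e)) (letter u (evalE σ f))
  evalT σ (not′ b) = not (evalT σ b)
  evalT σ (b ∧′ c) = evalT σ b ∧ evalT σ c

  infix 4 ⟨_,_⟩⇓[_]_

  -- ⟨ c , σ ⟩⇓[ t ] τ : started in σ, the command c halts in τ after t steps.
  data ⟨_,_⟩⇓[_]_ : Cmd → Store → ℕ → Store → Set where

    ⇓skip : ∀ {σ} → ⟨ skip , σ ⟩⇓[ 1 ] σ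

    ⇓var : ∀ {σ x e} →
      ⟨ x ≔ e , σ ⟩⇓[ 1 + costE e ] setVar σ x (evalE σ e)

    ⇓arr : ∀ {σ X e f} →
      ⟨ X [ e ]≔ f , σ ⟩⇓[ 1 + costE e + costE f ] setArr σ X (evalE σ e) (evalE σ f)

    ⇓seq : ∀ {σ τ ρ c d s t} →
      ⟨ c , σ ⟩⇓[ s ] τ →
      ⟨ d , τ ⟩⇓[ t ] ρ →
      ⟨ c ︔ d , σ ⟩⇓[ s + t ] ρ

    ⇓then : ∀ {σ τ b c d t} →
      evalT σ b ≡ true →
      ⟨ c , σ ⟩⇓[ t ] τ →
      ⟨ if′ b then c else d , σ ⟩⇓[ 1 + costT b + t ] τ

    ⇓else : ∀ {σ τ b c d t} →
      evalT σ b ≡ false →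
      ⟨ d , σ ⟩⇓[ t ] τ →
      ⟨ if′ b then c else d , σ ⟩⇓[ 1 + costT b + t ] τ

    ⇓done : ∀ {σ b c} →
      evalT σ b ≡ false →
      ⟨ while b loop c , σ ⟩⇓[ 1 + costT b ] σ

    ⇓loop : ∀ {σ τ ρ b c s t} →
      evalT σ b ≡ true →
      ⟨ c , σ ⟩⇓[ s ] τ →
      ⟨ while b loop c , τ ⟩⇓[ t ] ρ →
      ⟨ while b loop c , σ ⟩⇓[ 1 + costT b + s + t ] ρ

-- Runs c for x = lo, …, hi; meant for c not assigning x and hi not depending
-- on anything c modifies.
for_from_to_loop_ : Var → Expr → Expr → Cmd → Cmd
for x from lo to hi loop c =
  x ≔ lo ︔
  while not′ (hi ≺ var x) loop (c ︔ x ≔ suc′ (var x))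

------------------------------------------------------------------------
-- The procedure

i ls : Var
i  = 0
ls = 1

-- Larger numbers name scratch variables and arrays for the two subroutines.
P C R LSeed : Arr
P     = 0
C     = 1
R     = 2
LSeed = 3

computeLeftSeedArray : (computePeriods computeCovers : Cmd) → Cmd
computeLeftSeedArray computePeriods computeCovers =
  computePeriods ︔
  computeCovers ︔
  (for i from lit 0 to len loop (R [ var i ]≔ lit 0)) ︔
  (for i from lit 1 to len loop (R [ C [ var i ] ]≔ var i)) ︔
  ls ≔ lit 0 ︔
  (for i from lit 1 to len loop
    ((while R [ var ls ] ≺ P [ var i ] loop (ls ≔ suc′ (var ls))) ︔
     LSeed [ var i ]≔ var ls))

-- The memory is uninitialised: initial stores are arbitrary.

ComputesPeriodArray : Cmd → Set₁
ComputesPeriodArray c =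
  ∀ {A : Set} (_≟_ : DecidableEquality A) (u : List A) (σ : Store) →
  let open Semantics _≟_ u in
  ∃₂ λ t τ → ⟨ c , σ ⟩⇓[ t ] τ × IsPeriodArray u (arrays τ P)

-- The subroutine may use the period array, and has to leave it intact.
ComputesCoverArray : Cmd → Set₁
ComputesCoverArray c =
  ∀ {A : Set} (_≟_ : DecidableEquality A) (u : List A) (σ : Store) →
  IsPeriodArray u (arrays σ P) →
  let open Semantics _≟_ u in
  ∃₂ λ t τ → ⟨ c , σ ⟩⇓[ t ] τ × IsPeriodArray u (arrays τ P) × IsCoverArray u (arrays τ C)

-- c halts on every input u, within O(|u|) steps.
RunsInLinearTime : Cmd → Set₁
RunsInLinearTime c =
  ∃₂ λ (K n₀ : ℕ) →
  ∀ {A : Set} (_≟_ : DecidableEquality A) (u : List A) (σ : Store) →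
  let open Semantics _≟_ u in
  ∃₂ λ t τ → ⟨ c , σ ⟩⇓[ t ] τ × (n₀ ≤ length u → t ≤ K * length u)

{-# OPTIONS --safe #-}
module Submission where

open import Defs
open import Data.Bool.Base using (true; false; T; not; _∧_)
open import Data.List.Base using (List; []; _∷_; _++_; length; head; take; drop)
open import Data.List.Properties using (length-++; length-take; take++drop≡id; drop-drop)
open import Data.Maybe.Base using (just)
open import Data.Maybe.Properties using (just-injective)
open import Data.Nat.Base
open import Data.Nat.Properties
open import Data.Nat.Tactic.RingSolver using (solve-∀)
open import Data.Product.Base using (_×_; _,_; proj₁; proj₂; ∃; ∃₂; ∃-syntax)
open import Relation.Binary.Definitions using (DecidableEquality)
open import Relation.Binary.PropositionalEquality hiding ([_])
open import Relation.Nullary using (¬_; yes; no; contradiction)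

-- The period of u[1..i] is found by running through the periods of u[1..i−1] in
-- increasing order: after p comes p + P[i−1−p].  The candidate p never decreases
-- and is at most i, so all these searches together take O(n) steps.
--
-- A proper cover of u[1..i] also covers its longest border u[1..b], b = i − P[i];
-- hence C[i] is either C[b] or i.  It is C[b] iff the longest earlier prefix
-- with shortest cover C[b], whose length is kept in R, reaches i − C[b].
--
-- In the final loop ls never exceeds C[n], because R[C[n]] = n ≥ P[i].

-- Truncated subtraction and least elements.

m<n∸o⇒m+o<n : ∀ {m n o} → m < n ∸ o → m + o < n
m<n∸o⇒m+o<n {m} lt = m≤o∸n⇒m+n≤o (suc m) (<⇒≤ (m∸n≢0⇒n<m (m<n⇒n≢0 lt))) lt

IsLeast-unique : ∀ {Q m n} → IsLeast Q m → IsLeast Q n → m ≡ n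
IsLeast-unique (qm , minm) (qn , minn) = ≤-antisym (minm _ qn) (minn _ qm)

IsLeast-resp : ∀ {Q Q′ : ℕ → Set} {m} → (∀ k → Q k → Q′ k) → (∀ k → Q′ k → Q k) →
  IsLeast Q m → IsLeast Q′ m
IsLeast-resp to from (q , least) = to _ q , λ k q′ → least k (from k q′)

-- Periods and covers of prefixes, expressed by positions.

module Combinatorics {B : Set} (f : ℕ → B) where

  open ≡-Reasoning

  -- The range is given as `j + p ≤ i` instead of by a truncated difference, so that periods can be
  -- added and cancelled by rewriting sums.
  Period : ℕ → ℕ → Set
  Period i p = 1 ≤ p × (∀ j → 1 ≤ j → j + p ≤ i → f j ≡ f (j + p))

  Occurs : ℕ → ℕ → Set
  Occurs c k = ∀ m → 1 ≤ m → m ≤ c → f (k + m) ≡ f m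

  -- A cover of a nonempty word is a prefix of it, so its length `c` suffices to describe it.
  Covered : ℕ → ℕ → Set
  Covered i c = ∀ j → 1 ≤ j → j ≤ i →
    ∃ λ k → k < j × j ≤ k + c × k + c ≤ i × Occurs c k

  period-trivial : ∀ {i p} → 1 ≤ p → i ≤ p → Period i p
  period-trivial {p = p} 1≤p i≤p = 1≤p , λ where
    (suc j) _ le → contradiction (≤-trans le i≤p) (<⇒≱ (s≤s (m≤n+m p j)))

  period-restrict : ∀ {i i′ p} → i ≤ i′ → Period i′ p → Period i p
  period-restrict i≤i′ (1≤p , per) = 1≤p , λ j 1≤j le → per j 1≤j (≤-trans le i≤i′)

  period-extend : ∀ {m b p} → m ≡ b + p → Period m p → f (suc b) ≡ f (suc m) → Period (suc m) p
  period-extend {b = b} {p} refl (1≤p , per) last = 1≤p , ext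
    where
    ext : ∀ j → 1 ≤ j → j + p ≤ suc (b + p) → f j ≡ f (j + p)
    ext j 1≤j le with j ≤? b
    ... | yes j≤b = per j 1≤j (+-monoˡ-≤ p j≤b)
    ... | no j≰b with ≤-antisym (+-cancelʳ-≤ p j (suc b) le) (≰⇒> j≰b)
    ...   | refl = last

  -- A shift by `q` that stays inside the prefix of length `b` leaves room for a further shift by
  -- `p`.
  period-compose : ∀ {b p q} → Period (b + p) p → Period b q → Period (b + p) (p + q)
  period-compose {b} {p} {q} (1≤p , perp) (_ , perq) =
    ≤-trans 1≤p (m≤m+n p q) , λ j 1≤j le →
      let eq = trans (+-assoc j q p) (cong (j +_) (+-comm q p))
          le′ = subst (_≤ b + p) (sym eq) le
      in begin
        f j           ≡⟨ perq j 1≤j (+-cancelʳ-≤ p (j + q) b le′) ⟩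
        f (j + q)     ≡⟨ perp (j + q) (≤-trans 1≤j (m≤m+n j q)) le′ ⟩
        f (j + q + p) ≡⟨ cong f eq ⟩
        f (j + (p + q)) ∎

  -- Shift by `p + q`, then back by `p`.
  period-cancel : ∀ {b p q} → 1 ≤ q → Period (b + p) p → Period (b + p) (p + q) → Period b q
  period-cancel {b} {p} {q} 1≤q (_ , perp) (_ , perpq) =
    1≤q , λ j 1≤j le →
      let eq = trans (+-assoc j q p) (cong (j +_) (+-comm q p))
          le′ = +-monoˡ-≤ p le
      in begin
        f j             ≡⟨ perpq j 1≤j (subst (_≤ b + p) eq le′) ⟩
        f (j + (p + q)) ≡⟨ cong f eq ⟨
        f (j + q + p)   ≡⟨ perp (j + q) (≤-trans 1≤j (m≤m+n j q)) le′ ⟨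
        f (j + q) ∎

  -- A mismatch at position i = b + p + 1 rules out p, and the periods of the
  -- prefix of length i beyond p are p + q with q a period of the prefix of length b.
  next-period : ∀ {b p r} → Period (b + p) p → f (suc b) ≢ f (suc (b + p)) →
    (∀ q → Period (suc (b + p)) q → p ≤ q) → IsLeast (Period b) r →
    Period (b + p) (p + r) × p + r ≤ suc (b + p) ×
    (∀ q → Period (suc (b + p)) q → p + r ≤ q)
  next-period {b} {p} {r} per mismatch least (perr , leastr) =
    period-compose per perr ,
    -- The prefix of length `b` has the trivial period `suc b`, hence `r ≤ suc b`.
    ≤-trans (+-monoʳ-≤ p (leastr (suc b) (period-trivial (s≤s z≤n) (n≤1+n b))))
      (≤-reflexive (trans (+-suc p b) (cong suc (+-comm p b)))) ,
    next
    where
    next : ∀ q → Period (suc (b + p)) q → p + r ≤ q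
    next q perq with m≤n⇒∃[o]m+o≡n (least q perq)
    ... | zero , refl = contradiction
      (trans (proj₂ perq (suc b) (s≤s z≤n) (s≤s (+-monoʳ-≤ b (≤-reflexive (+-identityʳ p)))))
             (cong (λ x → f (suc (b + x))) (+-identityʳ p)))
      mismatch
    ... | suc d , refl = +-monoʳ-≤ p
      (leastr (suc d) (period-cancel (s≤s z≤n) per (period-restrict (n≤1+n (b + p)) perq)))

  -- Covers, borders and shortest covers.

  covered-self : ∀ i → Covered i i
  covered-self i j 1≤j j≤i = 0 , 1≤j , j≤i , ≤-refl , λ _ _ _ → refl

  covered-nonempty : ∀ {i c} → 1 ≤ i → Covered i c → 1 ≤ c
  covered-nonempty 1≤i cov with cov 1 ≤-refl 1≤i
  ... | zero , _ , 1≤c , _ = 1≤c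
  ... | suc k , s≤s () , _

  covered-bounded : ∀ {i c} → 1 ≤ i → Covered i c → c ≤ i
  covered-bounded 1≤i cov with cov 1 ≤-refl 1≤i
  ... | k , _ , _ , le , _ = ≤-trans (m≤n+m _ k) le

  -- The occurrence over the last position has to end there.
  covered-suffix : ∀ {i c} → 1 ≤ i → Covered i c → ∃ λ k → k + c ≡ i × Occurs c k
  covered-suffix 1≤i cov with cov _ 1≤i ≤-refl
  ... | k , _ , ge , le , occ = k , ≤-antisym le ge , occ

  -- An occurrence that starts after `k` may overrun the end `k + c`, but the positions it covers up
  -- to there are also covered by the occurrence at `k`.
  covered-restrict : ∀ {i c k} → Covered i c → Occurs c k → k + c ≤ i → Covered (k + c) c
  covered-restrict {c = c} {k} cov occ le j 1≤j j≤k+c with cov j 1≤j (≤-trans j≤k+c le)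
  ... | k′ , k′<j , j≤k′+c , _ , occ′ with k′ ≤? k
  ...   | yes k′≤k = k′ , k′<j , j≤k′+c , +-monoˡ-≤ c k′≤k , occ′
  ...   | no k′≰k = k , <-trans (≰⇒> k′≰k) k′<j , j≤k+c , ≤-refl , occ

  -- The final occurrence starts after position `e`, and `e ≤ k` leaves no gap behind the part
  -- already covered.
  covered-extend : ∀ {i c e k} → Covered k c → Occurs c e → e + c ≡ i → e ≤ k → k ≤ i → Covered i c
  covered-extend {k = k} cov occ refl e≤k k≤i j 1≤j j≤i with j ≤? k
  ... | no j≰k = _ , ≤-<-trans e≤k (≰⇒> j≰k) , j≤i , ≤-refl , occ
  ... | yes j≤k with cov j 1≤j j≤k
  ...   | k′ , lt , ge , le , occ′ = k′ , lt , ge , ≤-trans le k≤i , occ′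

  covered-trans : ∀ {i c d} → Covered c d → Covered i c → Covered i d
  covered-trans {c = c} {d} covd covc j 1≤j j≤i with covc j 1≤j j≤i
  -- Position `j` is position `suc o` inside the occurrence of the longer cover, where an occurrence
  -- of the shorter one is found.
  ... | k , k<j , j≤k+c , k+c≤i , occ with m≤n⇒∃[o]m+o≡n k<j
  ... | o , refl with covd (suc o) (s≤s z≤n)
                        (+-cancelˡ-≤ k (suc o) c (subst (_≤ k + c) (sym (+-suc k o)) j≤k+c))
  ... | k′ , s≤s k′≤o , o<k′+d , k′+d≤c , occ′ =
    k + k′ , s≤s (+-monoʳ-≤ k k′≤o) ,
    subst₂ _≤_ (+-suc k o) (sym (+-assoc k k′ d)) (+-monoʳ-≤ k o<k′+d) ,
    ≤-trans (≤-trans (≤-reflexive (+-assoc k k′ d)) (+-monoʳ-≤ k k′+d≤c)) k+c≤i ,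
    λ m 1≤m m≤d → begin
      f (k + k′ + m)   ≡⟨ cong f (+-assoc k k′ m) ⟩
      f (k + (k′ + m)) ≡⟨ occ (k′ + m) (≤-trans 1≤m (m≤n+m m k′))
                            (≤-trans (+-monoʳ-≤ k′ m≤d) k′+d≤c) ⟩
      f (k′ + m)       ≡⟨ occ′ m 1≤m m≤d ⟩
      f m ∎

  -- Both covers are suffixes of the same prefix, so the shorter is a suffix of the longer, and the
  -- covering by `d` can be cut off at `c`.
  covered-shorter : ∀ {i c d} → 1 ≤ i → d ≤ c → Covered i d → Covered i c → Covered c d
  covered-shorter {d = d} 1≤i d≤c covd covc
    with covered-suffix 1≤i covd | covered-suffix 1≤i covc | m≤n⇒∃[o]m+o≡n d≤c
  ... | kd , eqd , occd | kc , refl , occc | e , refl =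
    subst (λ c → Covered c d) (+-comm e d)
      (covered-restrict covd occ (≤-trans (≤-reflexive (+-comm e d)) (m≤n+m _ kc)))
    where
    kd≡ : kd ≡ kc + e
    kd≡ = +-cancelʳ-≡ d kd (kc + e)
      (trans eqd (trans (cong (kc +_) (+-comm d e)) (sym (+-assoc kc e d))))
    occ : Occurs d e
    occ m 1≤m m≤d = begin
      f (e + m)        ≡⟨ occc (e + m) (≤-trans 1≤m (m≤n+m m e))
                            (≤-trans (+-monoʳ-≤ e m≤d) (≤-reflexive (+-comm e d))) ⟨
      f (kc + (e + m)) ≡⟨ cong f (+-assoc kc e m) ⟨
      f (kc + e + m)   ≡⟨ cong (λ k → f (k + m)) kd≡ ⟨
      f (kd + m)       ≡⟨ occd m 1≤m m≤d ⟩
      f m ∎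

  shift-by-period : ∀ {b p c e m} → Period (b + p) p → e + c ≤ b → 1 ≤ m → m ≤ c →
    f (e + m) ≡ f (e + p + m)
  shift-by-period {p = p} {e = e} {m} (_ , per) le 1≤m m≤c =
    trans (per (e + m) (≤-trans 1≤m (m≤n+m m e))
            (+-monoˡ-≤ p (≤-trans (+-monoʳ-≤ e m≤c) le)))
          (cong f (trans (+-assoc e m p)
            (trans (cong (e +_) (+-comm m p)) (sym (+-assoc e p m)))))

  -- A proper cover is a border, so the start `k` of its last occurrence is a period; `p ≤ k` gives
  -- `c ≤ b`. Moved back by `p`, that occurrence ends at `b`, where the covering can be cut off.
  proper-cover-covers-border : ∀ {b p c} → IsLeast (Period (b + p)) p →
    Covered (b + p) c → c < b + p → c ≤ b × Covered b c
  proper-cover-covers-border {b} {p} {c} (per , least) cov c<i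
    with covered-suffix (≤-trans (s≤s z≤n) c<i) cov
  ... | k , eq , occ = c≤b , covb
    where
    1≤k : 1 ≤ k
    1≤k = n≢0⇒n>0 λ { refl → <⇒≢ c<i eq }
    p≤k : p ≤ k
    p≤k = least k (1≤k , λ j 1≤j le →
      sym (trans (cong f (+-comm j k))
        (occ j 1≤j (+-cancelʳ-≤ k j c (≤-trans le (≤-reflexive (trans (sym eq) (+-comm k c))))))))
    c≤b : c ≤ b
    c≤b = +-cancelʳ-≤ p c b (≤-trans (+-monoʳ-≤ c p≤k) (≤-reflexive (trans (+-comm c k) eq)))
    covb : Covered b c
    covb with m≤n⇒∃[o]m+o≡n c≤b
    ... | e , refl = subst (λ b → Covered b c) (+-comm e c)
      (covered-restrict cov occ′ (≤-trans (≤-reflexive (+-comm e c)) (m≤m+n _ p)))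
      where
      k≡ : e + p ≡ k
      k≡ = +-cancelˡ-≡ c (e + p) k (trans (sym (+-assoc c e p)) (trans (sym eq) (+-comm k c)))
      occ′ : Occurs c e
      occ′ m 1≤m m≤c = begin
        f (e + m)     ≡⟨ shift-by-period per (≤-reflexive (+-comm e c)) 1≤m m≤c ⟩
        f (e + p + m) ≡⟨ cong (λ k → f (k + m)) k≡ ⟩
        f (k + m)     ≡⟨ occ m 1≤m m≤c ⟩
        f m ∎

  -- The longest border is empty, which forces a proper cover to have length 0.
  least-cover-unbordered : ∀ {p} → IsLeast (Period p) p → IsLeast (Covered p) p
  least-cover-unbordered {p} least = covered-self p , λ d cov → ≮⇒≥ λ d<p →
    <⇒≱ (covered-nonempty (≤-trans (s≤s z≤n) d<p) cov)
        (proj₁ (proper-cover-covers-border {b = 0} least cov d<p))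

  -- The occurrence of `c` ending at `b`, moved by `p`, ends at `b + p` and starts no later than
  -- `k`. A shorter cover would be proper and would cover the border, against the minimality of `c`.
  least-cover-extend : ∀ {b p c e k} → 1 ≤ b → IsLeast (Period (b + p)) p → IsLeast (Covered b) c →
    e + c ≡ b + p → e ≤ k → k ≤ b + p → Covered k c → IsLeast (Covered (b + p)) c
  least-cover-extend {b} {p} {c} {e} 1≤b isPer@(per , _) (covb , least) e+c≡i e≤k k≤i covk =
    covered-extend covk occ e+c≡i e≤k k≤i ,
    λ d cov → ≮⇒≥ λ d<c →
      let d<i = <-≤-trans d<c (≤-trans (covered-bounded 1≤b covb) (m≤m+n b p))
      in <⇒≱ d<c (least d (proj₂ (proper-cover-covers-border isPer cov d<i)))
    where
    occ : Occurs c e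
    occ m 1≤m m≤c with covered-suffix 1≤b covb
    ... | k , refl , occ′ = begin
      f (e + m)     ≡⟨ cong (λ e → f (e + m)) e≡ ⟩
      f (k + p + m) ≡⟨ shift-by-period per ≤-refl 1≤m m≤c ⟨
      f (k + m)     ≡⟨ occ′ m 1≤m m≤c ⟩
      f m ∎
      where
      e≡ : e ≡ k + p
      e≡ = +-cancelʳ-≡ c e (k + p) (trans e+c≡i
        (trans (+-assoc k c p) (trans (cong (k +_) (+-comm c p)) (sym (+-assoc k p c)))))

  -- A proper cover of the prefix would itself be covered by c, so c would cover
  -- the prefix; the occurrence of c over position i − c then ends at a k that
  -- contradicts the hypothesis.
  least-cover-full : ∀ {b p c} → 1 ≤ b → IsLeast (Period (b + p)) p → IsLeast (Covered b) c →
    (∀ k → 1 ≤ k → k < b + p → Covered k c → k + c < b + p) → IsLeast (Covered (b + p)) (b + p)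
  least-cover-full {b} {p} {c} 1≤b isPer@((1≤p , _) , _) (covb , least) short =
    covered-self (b + p) , λ d cov → ≮⇒≥ λ d<i → absurd d cov d<i
    where
    c<i : c < b + p
    c<i = ≤-<-trans (covered-bounded 1≤b covb) (m<m+n b 1≤p)
    absurd : ∀ d → Covered (b + p) d → ¬ (d < b + p)
    absurd d cov d<i
      with covd ← proj₂ (proper-cover-covers-border isPer cov d<i)
      with covc ← covered-trans (covered-shorter 1≤b (least d covd) covb covd) cov
      with m≤n⇒∃[o]m+o≡n (<⇒≤ c<i)
    ... | e , c+e≡i with covc e (n≢0⇒n>0 λ { refl → <⇒≢ c<i (trans (sym (+-identityʳ c)) c+e≡i) })
                            (≤-trans (m≤n+m e c) (≤-reflexive c+e≡i))
    ... | k , k<e , e≤k+c , k+c≤i , occ =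
      <⇒≱ (+-cancelʳ-< c (k + c) e (<-≤-trans
            (short (k + c) (≤-trans (s≤s z≤n) (≤-trans k<e e≤k+c)) k+c<i (covered-restrict covc occ k+c≤i))
            (≤-reflexive (sym e+c≡i))))
          e≤k+c
      where
      e+c≡i : e + c ≡ b + p
      e+c≡i = trans (+-comm e c) c+e≡i
      k+c<i : k + c < b + p
      k+c<i = <-≤-trans (+-monoˡ-< c k<e) (≤-reflexive e+c≡i)

  -- A shorter cover of the prefix of length `k` would cover that of length `c`, and thereby that of
  -- length `b`.
  least-cover-transfer : ∀ {b c k} → 1 ≤ b → 1 ≤ k →
    IsLeast (Covered b) c → Covered k c → IsLeast (Covered k) c
  least-cover-transfer 1≤b 1≤k (covb , least) covk = covk , λ e cove → ≮⇒≥ λ e<c →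
    <⇒≱ e<c (least e (covered-trans (covered-shorter 1≤k (<⇒≤ e<c) cove covk) covb))

-- Letters of lists.

module _ {A : Set} where

  letter-just : ∀ (x : List A) j → 1 ≤ j → j ≤ length x → ∃ λ a → letter x j ≡ just a
  letter-just (a ∷ x) (suc zero) _ _ = a , refl
  letter-just (a ∷ x) (suc (suc j)) _ (s≤s le) = letter-just x (suc j) (s≤s z≤n) le

  letter-take : ∀ i j (x : List A) → j ≤ i → letter (take i x) j ≡ letter x j
  letter-take i zero x _ = refl
  letter-take (suc i) (suc j) [] _ = refl
  letter-take (suc i) (suc zero) (a ∷ x) _ = refl
  letter-take (suc i) (suc (suc j)) (a ∷ x) (s≤s le) = letter-take i (suc j) x le

  letter-++ˡ : ∀ j (s y : List A) → j ≤ length s → letter (s ++ y) j ≡ letter s j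
  letter-++ˡ zero s y _ = refl
  letter-++ˡ (suc zero) (a ∷ s) y _ = refl
  letter-++ˡ (suc (suc j)) (a ∷ s) y (s≤s le) = letter-++ˡ (suc j) s y le

  letter-++ʳ : ∀ j (x s : List A) → 1 ≤ j → letter (x ++ s) (length x + j) ≡ letter s j
  letter-++ʳ j [] s _ = refl
  letter-++ʳ (suc j) (a ∷ x) s 1≤j =
    trans (cong (λ k → letter (a ∷ (x ++ s)) (suc k)) (+-suc (length x) j))
      (trans (cong (letter (x ++ s)) (sym (+-suc (length x) j))) (letter-++ʳ (suc j) x s 1≤j))

  letter-drop : ∀ k j (x : List A) → 1 ≤ j → letter (drop k x) j ≡ letter x (k + j)
  letter-drop k (suc j) x _ =
    trans (cong head (drop-drop k j x)) (cong (letter x) (sym (+-suc k j)))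

  -- As `letter` yields `nothing` past the end, agreement up to `i` also rules out that just one of
  -- the lists ends earlier.
  take-ext : ∀ i (x y : List A) → (∀ j → 1 ≤ j → j ≤ i → letter x j ≡ letter y j) →
    take i x ≡ take i y
  take-ext zero x y _ = refl
  take-ext (suc i) [] [] _ = refl
  take-ext (suc i) [] (b ∷ y) eq = contradiction (eq 1 (s≤s z≤n) (s≤s z≤n)) λ ()
  take-ext (suc i) (a ∷ x) [] eq = contradiction (eq 1 (s≤s z≤n) (s≤s z≤n)) λ ()
  take-ext (suc i) (a ∷ x) (b ∷ y) eq = cong₂ _∷_
    (just-injective (eq 1 (s≤s z≤n) (s≤s z≤n)))
    (take-ext i x y λ { (suc j) _ le → eq (suc (suc j)) (s≤s z≤n) (s≤s le) })

-- Equivalence of the list definitions with the positional ones.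

module Prefixes {A : Set} (u : List A) where

  open Combinatorics (letter u)

  length-prefix : ∀ {i} → i ≤ length u → length (take i u) ≡ i
  length-prefix {i} i≤n = trans (length-take i u) (m≤n⇒m⊓n≡m i≤n)

  HasPeriod⇒Period : ∀ {i} p → i ≤ length u → HasPeriod (take i u) p → Period i p
  HasPeriod⇒Period {i} p i≤n (1≤p , per) = 1≤p , λ j 1≤j le →
    trans (sym (letter-take i j u (m+n≤o⇒m≤o j le)))
      (trans (per j 1≤j (subst (λ l → j ≤ l ∸ p) (sym (length-prefix i≤n)) (m+n≤o⇒m≤o∸n j le)))
        (letter-take i (j + p) u le))

  Period⇒HasPeriod : ∀ {i} p → i ≤ length u → Period i p → HasPeriod (take i u) p
  Period⇒HasPeriod {i} p i≤n (1≤p , per) = 1≤p , λ j 1≤j j≤l∸p →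
    let j≤i∸p = subst (λ l → j ≤ l ∸ p) (length-prefix i≤n) j≤l∸p
        -- Since `1 ≤ j`, the difference `i ∸ p` is positive and hence not truncated.
        p≤i = <⇒≤ (m∸n≢0⇒n<m (m<n⇒n≢0 (≤-trans 1≤j j≤i∸p)))
        le = m≤o∸n⇒m+n≤o j p≤i j≤i∸p
    in trans (letter-take i j u (m+n≤o⇒m≤o j le))
         (trans (per j 1≤j le) (sym (letter-take i (j + p) u le)))

  IsPer⇔ : ∀ {i p} → i ≤ length u → (IsPer (take i u) p → IsLeast (Period i) p) ×
    (IsLeast (Period i) p → IsPer (take i u) p)
  IsPer⇔ i≤n =
    IsLeast-resp (λ k → HasPeriod⇒Period k i≤n) (λ k → Period⇒HasPeriod k i≤n) ,
    IsLeast-resp (λ k → Period⇒HasPeriod k i≤n) (λ k → HasPeriod⇒Period k i≤n)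

  Cover : ℕ → ℕ → Set
  Cover i ℓ = ∃[ s ] (length s ≡ ℓ × Covers s (take i u))

  -- The occurrence over position 1 has nothing to its left, so `s` is a prefix and its letters can
  -- be replaced by those of `u`.
  Cover⇒Covered : ∀ {i} ℓ → 1 ≤ i → i ≤ length u → Cover i ℓ → Covered i ℓ
  Cover⇒Covered {i} ℓ 1≤i i≤n (s , refl , covers) j 1≤j j≤i
    with covers j 1≤j (subst (j ≤_) (sym (length-prefix i≤n)) j≤i)
  ... | x , y , eq , x<j , j≤x+s = length x , x<j , j≤x+s , x+s≤i x y eq ,
    λ m 1≤m m≤s → trans (occurrence x y eq m 1≤m m≤s) (sym (prefix m 1≤m m≤s))
    where
    x+s≤i : ∀ x y → take i u ≡ x ++ s ++ y → length x + length s ≤ i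
    x+s≤i x y eq = begin
      length x + length s              ≤⟨ +-monoʳ-≤ (length x) (m≤m+n (length s) (length y)) ⟩
      length x + (length s + length y) ≡⟨ cong (length x +_) (length-++ s) ⟨
      length x + length (s ++ y)       ≡⟨ length-++ x ⟨
      length (x ++ s ++ y)             ≡⟨ cong length eq ⟨
      length (take i u)                ≡⟨ length-prefix i≤n ⟩
      i ∎
      where
      open ≤-Reasoning
    occurrence : ∀ x y → take i u ≡ x ++ s ++ y → ∀ m → 1 ≤ m → m ≤ length s →
      letter u (length x + m) ≡ letter s m
    occurrence x y eq m 1≤m m≤s = begin
      letter u (length x + m)               ≡⟨ letter-take i (length x + m) u
                                                 (≤-trans (+-monoʳ-≤ (length x) m≤s) (x+s≤i x y eq)) ⟨
      letter (take i u) (length x + m)      ≡⟨ cong (λ w → letter w (length x + m)) eq ⟩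
      letter (x ++ s ++ y) (length x + m)   ≡⟨ letter-++ʳ m x (s ++ y) 1≤m ⟩
      letter (s ++ y) m                     ≡⟨ letter-++ˡ m s y m≤s ⟩
      letter s m ∎
      where open ≡-Reasoning
    prefix : ∀ m → 1 ≤ m → m ≤ length s → letter u m ≡ letter s m
    prefix m 1≤m m≤s with covers 1 ≤-refl (subst (1 ≤_) (sym (length-prefix i≤n)) 1≤i)
    ... | [] , y , eq , _ = occurrence [] y eq m 1≤m m≤s
    ... | _ ∷ _ , _ , _ , s≤s () , _

  Covered⇒Cover : ∀ {i} ℓ → 1 ≤ i → i ≤ length u → Covered i ℓ → Cover i ℓ
  Covered⇒Cover {i} ℓ 1≤i i≤n cov = take ℓ w , length-s , covers
    where
    w = take i u
    ℓ≤i = covered-bounded 1≤i cov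
    length-s : length (take ℓ w) ≡ ℓ
    length-s = trans (length-take ℓ w)
      (m≤n⇒m⊓n≡m (subst (ℓ ≤_) (sym (length-prefix i≤n)) ℓ≤i))
    covers : Covers (take ℓ w) w
    covers j 1≤j j≤w with cov j 1≤j (subst (j ≤_) (length-prefix i≤n) j≤w)
    ... | k , k<j , j≤k+ℓ , k+ℓ≤i , occ =
      take k w , drop ℓ (drop k w) , decompose ,
      subst (_< j) (sym length-x) k<j ,
      subst₂ (λ a b → j ≤ a + b) (sym length-x) (sym length-s) j≤k+ℓ
      where
      length-x : length (take k w) ≡ k
      length-x = trans (length-take k w)
        (m≤n⇒m⊓n≡m (subst (k ≤_) (sym (length-prefix i≤n)) (m+n≤o⇒m≤o k k+ℓ≤i)))
      open ≡-Reasoning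
      same : ∀ m → 1 ≤ m → m ≤ ℓ → letter w m ≡ letter (drop k w) m
      same m 1≤m m≤ℓ = begin
        letter w m          ≡⟨ letter-take i m u (≤-trans m≤ℓ ℓ≤i) ⟩
        letter u m          ≡⟨ occ m 1≤m m≤ℓ ⟨
        letter u (k + m)    ≡⟨ letter-take i (k + m) u (≤-trans (+-monoʳ-≤ k m≤ℓ) k+ℓ≤i) ⟨
        letter w (k + m)    ≡⟨ letter-drop k m w 1≤m ⟨
        letter (drop k w) m ∎
      decompose : w ≡ take k w ++ take ℓ w ++ drop ℓ (drop k w)
      decompose = begin
        w ≡⟨ take++drop≡id k w ⟨
        take k w ++ drop k w ≡⟨ cong (take k w ++_) (take++drop≡id ℓ (drop k w)) ⟨
        take k w ++ take ℓ (drop k w) ++ drop ℓ (drop k w)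
          ≡⟨ cong (λ s → take k w ++ s ++ drop ℓ (drop k w)) (take-ext ℓ w (drop k w) same) ⟨
        take k w ++ take ℓ w ++ drop ℓ (drop k w) ∎

  IsCover⇔ : ∀ {i c} → 1 ≤ i → i ≤ length u → (IsCover (take i u) c → IsLeast (Covered i) c) ×
    (IsLeast (Covered i) c → IsCover (take i u) c)
  IsCover⇔ 1≤i i≤n =
    IsLeast-resp (λ k → Cover⇒Covered k 1≤i i≤n) (λ k → Covered⇒Cover k 1≤i i≤n) ,
    IsLeast-resp (λ k → Covered⇒Cover k 1≤i i≤n) (λ k → Cover⇒Covered k 1≤i i≤n)

-- Boolean tests and array updates.

<ᵇ-true : ∀ {m n} → (m <ᵇ n) ≡ true → m < n
<ᵇ-true {m} {n} eq = <ᵇ⇒< m n (subst T (sym eq) _)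

<ᵇ-false : ∀ {m n} → (m <ᵇ n) ≡ false → n ≤ m
<ᵇ-false eq = ≮⇒≥ λ m<n → subst T eq (<⇒<ᵇ m<n)

update-same : ∀ {B : Set} (g : ℕ → B) k b → (g [ k ↦ b ]) k ≡ b
update-same g k b with k ≡ᵇ k | ≡⇒≡ᵇ k k refl
... | true | _ = refl

update-other : ∀ {B : Set} (g : ℕ → B) {k m} b → m ≢ k → (g [ k ↦ b ]) m ≡ g m
update-other g {k} {m} b m≢k with m ≡ᵇ k in eq
... | true  = contradiction (≡ᵇ⇒≡ m k (subst T (sym eq) _)) m≢k
... | false = refl

update-below : ∀ {Q : ℕ → ℕ → Set} {g k v} → (∀ j → j < k → Q j (g j)) → Q k v →
  ∀ j → j < suc k → Q j ((g [ k ↦ v ]) j)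
update-below {Q} {g} {k} {v} below here j j<1+k with j ≟ k
... | yes refl = subst (Q k) (sym (update-same g k v)) here
... | no j≢k = subst (Q j) (sym (update-other g v j≢k)) (below j (≤∧≢⇒< (s≤s⁻¹ j<1+k) j≢k))

-- Invariants of the period and cover tables.

module Tables {B : Set} (f : ℕ → B) where

  open Combinatorics f

  -- State of the search for the period of the prefix of length `suc m`: all values below `p` are
  -- ruled out.
  Candidate : ℕ → ℕ → Set
  Candidate m p = Period m p × p ≤ suc m × (∀ q → Period (suc m) q → p ≤ q)

  candidate-next : ∀ {m p r} → Candidate m p → p ≤ m → f (suc m) ≢ f (suc m ∸ p) →
    IsLeast (Period (m ∸ p)) r → Candidate m (p + r)
  candidate-next {p = p} (per , _ , least) p≤m mismatch leastr with m≤n⇒∃[o]m+o≡n p≤m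
  ... | b , refl rewrite +-comm p b | +-∸-assoc 1 (m≤n+m p b) | m+n∸n≡m b p =
    next-period per (λ eq → mismatch (sym eq)) least leastr

  candidate-accept : ∀ {m p} → Candidate m p → (p ≤ m → f (suc m) ≡ f (suc m ∸ p)) →
    IsLeast (Period (suc m)) p
  candidate-accept {m} {p} (per , p≤1+m , least) match with p ≤? m
  ... | no p≰m = period-trivial (proj₁ per) (≰⇒> p≰m) , least
  ... | yes p≤m =
    period-extend (sym (m∸n+n≡m p≤m)) per
      (sym (trans (match p≤m) (cong f (+-∸-assoc 1 p≤m)))) , least

  -- Periods of the longer prefix are periods of the shorter one, so the search resumes at `p`
  -- instead of restarting.
  candidate-advance : ∀ {m p} → IsLeast (Period m) p → p ≤ suc m → Candidate m p
  candidate-advance {m} (per , least) p≤1+m =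
    per , p≤1+m , λ q perq → least q (period-restrict (n≤1+n m) perq)

  -- Index 0 is included: the empty prefix has least period 1, which moves the candidate from `m` to
  -- `suc m`.
  PeriodTable : ℕ → (ℕ → ℕ) → Set
  PeriodTable k T = ∀ j → j < k → IsLeast (Period j) (T j)

  -- R maps the length of a shortest cover to the longest prefix, among those of
  -- length less than k, that it covers.
  CoverTable : ℕ → (ℕ → ℕ) → (ℕ → ℕ) → Set
  CoverTable k C R = C 0 ≡ 0 × R 0 ≡ 0 × (∀ m → 1 ≤ m → m < k →
    IsLeast (Covered m) (C m) × m ≤ R (C m) × R (C m) < k × Covered (R (C m)) (C m))

  module _ {k p} C R (1≤k : 1 ≤ k) (table : CoverTable k C R) (isPer : IsLeast (Period k) p) where

    private
      c = C (k ∸ p)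
      p≤k = proj₂ isPer k (period-trivial 1≤k ≤-refl)
      entries = proj₂ (proj₂ table)
      b<k = ∸-monoʳ-< {k} {p} {0} (proj₁ (proj₁ isPer)) p≤k

    cover-kept : k ∸ c ≤ R c → IsLeast (Covered k) c
    cover-kept reach with k ∸ p in eq | m∸n+n≡m p≤k
    -- For an empty border the zero entries `C 0` and `R 0` turn `reach` into `k ≤ 0`.
    ... | zero | _ = contradiction reach
      (subst₂ (λ c r → k ∸ c ≰ r) (sym (proj₁ table))
        (sym (trans (cong R (proj₁ table)) (proj₁ (proj₂ table)))) (<⇒≱ 1≤k))
    ... | b@(suc _) | refl with entries b (s≤s z≤n) (subst (_< b + p) eq b<k)
    ...   | isCover , _ , R<k , cov =
      least-cover-extend (s≤s z≤n) isPer isCover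
        (m∸n+n≡m (≤-trans (covered-bounded (s≤s z≤n) (proj₁ isCover)) (m≤m+n b p)))
        reach (<⇒≤ R<k) cov

    cover-full : R c < k ∸ c → IsLeast (Covered k) k
    cover-full far with k ∸ p in eq | m∸n+n≡m p≤k
    ... | zero | refl = least-cover-unbordered isPer
    ... | b@(suc _) | refl with entries b (s≤s z≤n) (subst (_< b + p) eq b<k)
    ...   | isCover , _ = least-cover-full (s≤s z≤n) isPer isCover short
      where
      short : ∀ m → 1 ≤ m → m < b + p → Covered m (C b) → m + C b < b + p
      -- `C b` is the shortest cover of the prefix of length `m` as well, so the table gives
      -- `m ≤ R (C b)`.
      short m 1≤m m<k cov = m<n∸o⇒m+o<n (≤-<-trans
        (subst (λ c → m ≤ R c)
          (IsLeast-unique (proj₁ (entries m 1≤m m<k)) (least-cover-transfer (s≤s z≤n) 1≤m isCover cov))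
          (proj₁ (proj₂ (entries m 1≤m m<k))))
        far)

  -- Older entries with shortest cover `e` also stay valid: `k` exceeds them and is itself covered
  -- by `e`.
  cover-update : ∀ {k e} C R → 1 ≤ k → CoverTable k C R → IsLeast (Covered k) e →
    CoverTable (suc k) (C [ k ↦ e ]) (R [ e ↦ k ])
  cover-update {k} {e} C R 1≤k (C0 , R0 , entries) isCover =
    trans (update-other C e (<⇒≢ 1≤k)) C0 ,
    trans (update-other R k (<⇒≢ (covered-nonempty 1≤k (proj₁ isCover)))) R0 ,
    λ m 1≤m m<1+k → update-below {Q = λ m c → 1 ≤ m → Entry m c} {C} {k} {e} old (λ _ → new) m m<1+k 1≤m
    where
    R′ = R [ e ↦ k ]
    Entry : ℕ → ℕ → Set
    Entry m c = IsLeast (Covered m) c × m ≤ R′ c × R′ c < suc k × Covered (R′ c) c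
    new : Entry k e
    new rewrite update-same R e k = isCover , ≤-refl , ≤-refl , proj₁ isCover
    old : ∀ m → m < k → 1 ≤ m → Entry m (C m)
    old m m<k 1≤m with entries m 1≤m m<k | C m ≟ e
    ... | isCover′ , _ | yes refl rewrite update-same R (C m) k =
      isCover′ , <⇒≤ m<k , ≤-refl , proj₁ isCover
    ... | isCover′ , m≤R , R<k , cov | no c≢e rewrite update-other R k c≢e =
      isCover′ , m≤R , m<n⇒m<1+n R<k , cov

-- Affine cost bounds.

affine-+ : ∀ a b c d n {s t} → s ≤ a + b * n → t ≤ c + d * n → s + t ≤ (a + c) + (b + d) * n
affine-+ a b c d n s≤ t≤ = ≤-trans (+-mono-≤ s≤ t≤) (≤-reflexive (collect a b c d n))
  where
  collect : ∀ a b c d n → a + b * n + (c + d * n) ≡ a + c + (b + d) * n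
  collect = solve-∀

affine⇒linear : ∀ a b {n t} → 1 ≤ n → t ≤ a + b * n → t ≤ (a + b) * n
affine⇒linear a b {n} {t} 1≤n t≤ = begin
  t             ≤⟨ t≤ ⟩
  a + b * n     ≡⟨ cong (_+ b * n) (*-identityʳ a) ⟨
  a * 1 + b * n ≤⟨ +-monoˡ-≤ (b * n) (*-monoʳ-≤ a 1≤n) ⟩
  a * n + b * n ≡⟨ *-distribʳ-+ n a b ⟨
  (a + b) * n   ∎
  where open ≤-Reasoning

-- The subroutines for periods and covers.

period cover : Var
period = 2
cover  = 3

-- The first conjunct keeps `i - period` inside the input, where a failed letter test means distinct
-- letters.
mismatch : Test
mismatch = (var period ≺ var i) ∧′ not′ (var i ≟u (var i ⊝ var period))

-- With b = i − 1 − period this sets period to period + P[b]; for lack of an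
-- addition the sum is computed as i − ((i − period) − P[b]).
nextPeriod : Cmd
nextPeriod = period ≔ var i ⊝ ((var i ⊝ var period) ⊝ P [ var i ⊝ suc′ (var period) ])

computePeriods : Cmd
computePeriods =
  P [ lit 0 ]≔ lit 1 ︔
  period ≔ lit 1 ︔
  (for i from lit 1 to len loop
    ((while mismatch loop nextPeriod) ︔
     P [ var i ]≔ var period))

-- `R` can serve as work space, because the main procedure clears it before filling it.
computeCovers : Cmd
computeCovers =
  C [ lit 0 ]≔ lit 0 ︔
  R [ lit 0 ]≔ lit 0 ︔
  (for i from lit 1 to len loop
    (cover ≔ C [ var i ⊝ P [ var i ] ] ︔
     (if′ R [ var cover ] ≺ (var i ⊝ var cover) then cover ≔ var i else skip) ︔
     C [ var i ]≔ var cover ︔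
     R [ var cover ]≔ var i))

-- Amortised rules for loops.

module Execution {A : Set} (_≟A_ : DecidableEquality A) (u : List A) where

  open Semantics _≟A_ u
  open Combinatorics (letter u)
  open Tables (letter u)
  open Prefixes u

  n : ℕ
  n = length u

  Run : Cmd → Store → (ℕ → Store → Set) → Set
  Run c σ Q = ∃₂ λ t τ → ⟨ c , σ ⟩⇓[ t ] τ × Q t τ

  -- The potential pays for guard and body of every iteration. Each costs at least 1, so a bound `N`
  -- on the potential also serves for the recursion that proves termination.
  while-run : ∀ {b c} (I : Store → Set) (Φ : Store → ℕ) →
    (∀ σ → I σ → evalT σ b ≡ true → Run c σ λ t τ → I τ × 1 + costT b + t + Φ τ ≤ Φ σ) →
    ∀ σ → I σ → Run (while b loop c) σ λ t τ →
      I τ × evalT τ b ≡ false × t + Φ τ ≤ 1 + costT b + Φ σ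
  while-run {b} {c} I Φ body σ = go (Φ σ) σ ≤-refl
    where
    go : ∀ N σ → Φ σ ≤ N → I σ → Run (while b loop c) σ λ t τ →
      I τ × evalT τ b ≡ false × t + Φ τ ≤ 1 + costT b + Φ σ
    go N σ Φ≤N inv with evalT σ b in eq
    ... | false = _ , _ , ⇓done eq , inv , eq , ≤-refl
    ... | true with body σ inv eq
    go zero σ Φ≤N inv | true | _ , _ , _ , _ , le =
      contradiction (≤-trans le Φ≤N) λ ()
    go (suc N) σ Φ≤N inv | true | s , τ , run , inv′ , le
      with go N τ (s≤s⁻¹ (≤-trans (s≤s (m≤n+m (Φ τ) (costT b + s))) (≤-trans le Φ≤N))) inv′
    ... | t , ρ , run′ , inv″ , eq′ , le′ = _ , ρ , ⇓loop eq run run′ , inv″ , eq′ , (begin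
      1 + costT b + s + t + Φ ρ               ≡⟨ +-assoc (1 + costT b + s) t (Φ ρ) ⟩
      1 + costT b + s + (t + Φ ρ)             ≤⟨ +-monoʳ-≤ (1 + costT b + s) le′ ⟩
      1 + costT b + s + (1 + costT b + Φ τ)   ≡⟨ shuffle (1 + costT b) s (Φ τ) ⟩
      1 + costT b + (1 + costT b + s + Φ τ)   ≤⟨ +-monoʳ-≤ (1 + costT b) le ⟩
      1 + costT b + Φ σ                       ∎)
      where
      open ≤-Reasoning
      shuffle : ∀ x y z → x + y + (x + z) ≡ x + (x + y + z)
      shuffle = solve-∀

  next : Store → Store
  next τ = setVar τ i (suc (scalars τ i))

  -- Inv k is the invariant before the iteration for i = k; a is the amortised
  -- cost of the body with respect to the potential Ψ.
  for-run : ∀ {c} lo a (Inv : ℕ → Store → Set) (Ψ : Store → ℕ) →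
    (∀ k σ → lo ≤ k → k ≤ n → scalars σ i ≡ k → Inv k σ →
      Run c σ λ t τ → scalars τ i ≡ k × Inv (suc k) (next τ) × t + Ψ (next τ) ≤ a + Ψ σ) →
    ∀ σ → lo ≤ suc n → Inv lo (setVar σ i lo) →
    Run (for i from lit lo to len loop c) σ λ t τ →
      Inv (suc n) τ × t + Ψ τ ≤ 7 + (8 + a) * (suc n ∸ lo) + Ψ (setVar σ i lo)
  for-run {c} lo a Inv Ψ body σ lo≤1+n inv =
    let t , τ , run , (_ , i≤1+n , inv′) , exit , le =
          while-run I Φ iterate (setVar σ i lo) (≤-refl , lo≤1+n , inv)
    in _ , τ , ⇓seq ⇓var run ,
       subst (λ k → Inv k τ) (≤-antisym i≤1+n (exited exit)) inv′ ,
       (begin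
         2 + t + Ψ τ                                          ≤⟨ s≤s (s≤s (+-monoʳ-≤ t (m≤n+m (Ψ τ) _))) ⟩
         2 + (t + Φ τ)                                        ≤⟨ s≤s (s≤s le) ⟩
         7 + ((8 + a) * (suc n ∸ lo) + Ψ (setVar σ i lo))     ≡⟨ +-assoc 7 ((8 + a) * (suc n ∸ lo)) _ ⟨
         7 + (8 + a) * (suc n ∸ lo) + Ψ (setVar σ i lo)       ∎)
    where
    open ≤-Reasoning
    exited : ∀ {k} → not (n <ᵇ k) ≡ false → suc n ≤ k
    exited {k} exit with n <ᵇ k in eq
    ... | true = <ᵇ-true eq
    I : Store → Set
    I σ = lo ≤ scalars σ i × scalars σ i ≤ suc n × Inv (scalars σ i) σ
    Φ : Store → ℕ
    -- A remaining iteration is charged 5 for the guard, 3 for the increment and `a` for the body.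
    -- The 7 in the final bound is 2 for initialising `i` plus 5 for the failing guard.
    Φ σ = (8 + a) * (suc n ∸ scalars σ i) + Ψ σ
    shuffle₁ : ∀ t x y → 5 + (t + 3) + (x + y) ≡ 8 + x + (t + y)
    shuffle₁ = solve-∀
    shuffle₂ : ∀ a x y → 8 + x + (a + y) ≡ 8 + a + x + y
    shuffle₂ = solve-∀
    iterate : ∀ σ → I σ → evalT σ (not′ (len ≺ var i)) ≡ true →
      Run (c ︔ i ≔ suc′ (var i)) σ λ t τ → I τ × 5 + t + Φ τ ≤ Φ σ
    iterate σ (lo≤k , _ , inv) guard with n <ᵇ scalars σ i in eq
    ... | false =
      let k = scalars σ i
          k≤n = <ᵇ-false {n} eq
          t , τ , run , i≡k , inv′ , le = body k σ lo≤k k≤n refl inv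
      in _ , _ , ⇓seq run ⇓var ,
         subst (λ k′ → lo ≤ k′ × k′ ≤ suc n × Inv k′ (next τ)) (cong suc (sym i≡k))
           (m≤n⇒m≤1+n lo≤k , s≤s k≤n , inv′) ,
         (begin
           5 + (t + 3) + ((8 + a) * (n ∸ scalars τ i) + Ψ (next τ))
             ≡⟨ shuffle₁ t ((8 + a) * (n ∸ scalars τ i)) (Ψ (next τ)) ⟩
           8 + (8 + a) * (n ∸ scalars τ i) + (t + Ψ (next τ))
             ≡⟨ cong (λ k → 8 + (8 + a) * (n ∸ k) + (t + Ψ (next τ))) i≡k ⟩
           8 + (8 + a) * (n ∸ k) + (t + Ψ (next τ))
             ≤⟨ +-monoʳ-≤ (8 + (8 + a) * (n ∸ k)) le ⟩
           8 + (8 + a) * (n ∸ k) + (a + Ψ σ)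
             ≡⟨ shuffle₂ a ((8 + a) * (n ∸ k)) (Ψ σ) ⟩
           (8 + a) + (8 + a) * (n ∸ k) + Ψ σ
             ≡⟨ cong (_+ Ψ σ) (*-suc (8 + a) (n ∸ k)) ⟨
           (8 + a) * suc (n ∸ k) + Ψ σ
             ≡⟨ cong (λ m → (8 + a) * m + Ψ σ) (+-∸-assoc 1 k≤n) ⟨
           (8 + a) * (suc n ∸ k) + Ψ σ ∎)

  sameLetter-true : ∀ x y → sameLetter x y ≡ true → x ≡ y
  sameLetter-true (just a) (just b) eq with a ≟A b
  ... | yes refl = refl

  sameLetter-false : ∀ {a b} x y → x ≡ just a → y ≡ just b → sameLetter x y ≡ false → x ≢ y
  sameLetter-false {a} {b} _ _ refl refl eq refl with a ≟A a
  ... | no a≢a = a≢a refl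

  mismatch-true : ∀ {k m p} → k ≡ suc m → m < n → 1 ≤ p →
    (p <ᵇ k) ∧ not (sameLetter (letter u k) (letter u (k ∸ p))) ≡ true →
    p ≤ m × letter u (suc m) ≢ letter u (suc m ∸ p)
  mismatch-true {m = m} {p} refl m<n 1≤p eq
    with p <ᵇ suc m in lt | sameLetter (letter u (suc m)) (letter u (suc m ∸ p)) in same
  ... | true | false =
    let p<1+m = <ᵇ-true {p} lt
    in s≤s⁻¹ p<1+m ,
       sameLetter-false _ _ (proj₂ (letter-just u (suc m) (s≤s z≤n) m<n))
         (proj₂ (letter-just u (suc m ∸ p) (m<n⇒0<n∸m p<1+m) (≤-trans (m∸n≤m (suc m) p) m<n))) same

  mismatch-false : ∀ {k m p} → k ≡ suc m →
    (p <ᵇ k) ∧ not (sameLetter (letter u k) (letter u (k ∸ p))) ≡ false →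
    p ≤ m → letter u (suc m) ≡ letter u (suc m ∸ p)
  mismatch-false {m = m} {p} refl eq p≤m
    with p <ᵇ suc m in lt | sameLetter (letter u (suc m)) (letter u (suc m ∸ p)) in same
  ... | false | _ = contradiction (s≤s p≤m) (≤⇒≯ (<ᵇ-false {p} lt))
  ... | true | true = sameLetter-true _ _ same

  -- Correctness and cost of the period computation.

  module Periods where

    -- Replacing the candidate costs 11 for the guard and 12 for the assignment; the new candidate
    -- is larger and at most `n`.
    Ψ : Store → ℕ
    Ψ σ = 23 * (n ∸ scalars σ period)

    Inner : ℕ → Store → Set
    Inner m σ = scalars σ i ≡ suc m × PeriodTable (suc m) (arrays σ P) × Candidate m (scalars σ period)

    Outer : ℕ → Store → Set
    Outer k σ = PeriodTable k (arrays σ P) × Candidate (pred k) (scalars σ period)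

    advance : ∀ {m} → m < n → ∀ σ → Inner m σ → evalT σ mismatch ≡ true →
      Run nextPeriod σ λ t τ → Inner m τ × 11 + t + Ψ τ ≤ Ψ σ
    advance {m} m<n σ (i≡1+m , table , cand@(per , _)) guard =
      _ , _ , ⇓var , (i≡1+m , table , subst (Candidate m) (sym (sum i≡1+m)) cand′) , (begin
        23 + 23 * (n ∸ p′)      ≡⟨ cong (λ p → 23 + 23 * (n ∸ p)) (sum i≡1+m) ⟩
        23 + 23 * (n ∸ (p + r)) ≡⟨ *-suc 23 (n ∸ (p + r)) ⟨
        23 * suc (n ∸ (p + r))  ≤⟨ *-monoʳ-≤ 23 (∸-monoʳ-< (m<m+n p (proj₁ (proj₁ isPer)))
                                     (≤-trans (proj₁ (proj₂ cand′)) m<n)) ⟩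
        23 * (n ∸ p) ∎)
      where
      open ≤-Reasoning
      p = scalars σ period
      r = arrays σ P (m ∸ p)
      p′ = evalE σ (var i ⊝ ((var i ⊝ var period) ⊝ P [ var i ⊝ suc′ (var period) ]))
      guarded = mismatch-true {m = m} {p} i≡1+m m<n (proj₁ per) guard
      isPer : IsLeast (Period (m ∸ p)) r
      isPer = table (m ∸ p) (s≤s (m∸n≤m m p))
      cand′ : Candidate m (p + r)
      cand′ = candidate-next cand (proj₁ guarded) (proj₂ guarded) isPer
      sum : ∀ {k} → k ≡ suc m → k ∸ ((k ∸ p) ∸ arrays σ P (k ∸ suc p)) ≡ p + r
      -- Nothing is truncated here, because `p + r ≤ suc m`.
      sum refl = trans (cong (suc m ∸_) (∸-+-assoc (suc m) p r)) (m∸[m∸n]≡n (proj₁ (proj₂ cand′)))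

    body : ∀ k σ → 1 ≤ k → k ≤ n → scalars σ i ≡ k → Outer k σ →
      Run ((while mismatch loop nextPeriod) ︔ P [ var i ]≔ var period) σ λ t τ →
        scalars τ i ≡ k × Outer (suc k) (next τ) × t + Ψ (next τ) ≤ 14 + Ψ σ
    body (suc m) σ _ m<n i≡1+m (table , cand)
      with while-run (Inner m) Ψ (advance m<n) σ (i≡1+m , table , cand)
    ... | t , τ , run , (i≡1+m′ , table′ , cand′) , exit , le =
      _ , _ , ⇓seq run ⇓arr , i≡1+m′ ,
      (subst (λ k → PeriodTable (suc (suc m)) (arrays τ P [ k ↦ scalars τ period ])) (sym i≡1+m′)
         (update-below {Q = λ j p → IsLeast (Period j) p} table′ isPer) ,
       candidate-advance isPer (m≤n⇒m≤1+n (proj₁ (proj₂ cand′)))) ,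
      -- The amortised 14 is 11 for the failing guard and 3 for storing the period.
      ≤-trans (≤-reflexive (trans (cong (_+ Ψ τ) (+-comm t 3)) (+-assoc 3 t (Ψ τ)))) (+-monoʳ-≤ 3 le)
      where
      isPer : IsLeast (Period (suc m)) (scalars τ period)
      isPer = candidate-accept cand′ (mismatch-false i≡1+m′ exit)

    run : ∀ σ → Run computePeriods σ λ t τ → IsPeriodArray u (arrays τ P) × t ≤ 12 + 45 * n
    run σ with for-run 1 14 Outer Ψ body _ (s≤s z≤n) (table₁ , candidate₁)
      where
      table₁ : PeriodTable 1 (arrays σ P [ 0 ↦ 1 ])
      table₁ zero _ = period-trivial ≤-refl z≤n , λ _ → proj₁
      table₁ (suc j) (s≤s ())
      candidate₁ : Candidate 0 1
      candidate₁ = period-trivial ≤-refl z≤n , ≤-refl , λ _ → proj₁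
    ... | t , τ , run , (table , _) , le =
      _ , _ , ⇓seq ⇓arr (⇓seq ⇓var run) ,
      (λ j 1≤j j≤n → proj₂ (IsPer⇔ j≤n) (table j (s≤s j≤n))) ,
      (begin
        5 + t                              ≤⟨ +-monoʳ-≤ 5 (m+n≤o⇒m≤o t le) ⟩
        12 + (22 * n + 23 * (n ∸ 1))       ≤⟨ +-monoʳ-≤ (12 + 22 * n) (*-monoʳ-≤ 23 (m∸n≤m n 1)) ⟩
        12 + (22 * n + 23 * n)             ≡⟨ cong (12 +_) (*-distribʳ-+ n 22 23) ⟨
        12 + 45 * n                        ∎)
      where
      open ≤-Reasoning

  -- Correctness and cost of the cover computation.

  module Covers where

    Inv : ℕ → Store → Set
    Inv k σ = IsPeriodArray u (arrays σ P) × CoverTable k (arrays σ C) (arrays σ R)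

    body : ∀ k σ → 1 ≤ k → k ≤ n → scalars σ i ≡ k → Inv k σ →
      Run (cover ≔ C [ var i ⊝ P [ var i ] ] ︔
           (if′ R [ var cover ] ≺ (var i ⊝ var cover) then cover ≔ var i else skip) ︔
           C [ var i ]≔ var cover ︔
           R [ var cover ]≔ var i) σ λ t τ →
        scalars τ i ≡ k × Inv (suc k) (next τ) × t + 0 ≤ 21 + 0
    body _ σ 1≤k k≤n refl (periods , table)
      with arrays σ R c <ᵇ (scalars σ i ∸ c) in test
      where c = evalE σ (C [ var i ⊝ P [ var i ] ])
    ... | true = _ , _ , ⇓seq ⇓var (⇓seq (⇓then test ⇓var) (⇓seq ⇓arr ⇓arr)) , refl ,
      (periods , cover-update (arrays σ C) (arrays σ R) 1≤k table
        (cover-full (arrays σ C) (arrays σ R) 1≤k table (proj₁ (IsPer⇔ k≤n) (periods _ 1≤k k≤n)) (<ᵇ-true test))) ,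
      ≤-refl
    ... | false = _ , _ , ⇓seq ⇓var (⇓seq (⇓else test ⇓skip) (⇓seq ⇓arr ⇓arr)) , refl ,
      (periods , cover-update (arrays σ C) (arrays σ R) 1≤k table
        (cover-kept (arrays σ C) (arrays σ R) 1≤k table (proj₁ (IsPer⇔ k≤n) (periods _ 1≤k k≤n)) (<ᵇ-false test))) ,
      -- The branch with `skip` is one step cheaper than the other.
      n≤1+n 20

    run : ∀ σ → IsPeriodArray u (arrays σ P) → Run computeCovers σ λ t τ →
      IsPeriodArray u (arrays τ P) × IsCoverArray u (arrays τ C) × t ≤ 13 + 29 * n
    run σ periods
      with for-run 1 21 Inv (λ _ → 0) body _ (s≤s z≤n)
             (periods , refl , refl , λ m 1≤m m<1 → contradiction 1≤m (<⇒≱ m<1))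
    ... | t , τ , run , (periods′ , _ , _ , entries) , le =
      _ , _ , ⇓seq ⇓arr (⇓seq ⇓arr run) , periods′ ,
      (λ j 1≤j j≤n → proj₂ (IsCover⇔ 1≤j j≤n) (proj₁ (entries j 1≤j (s≤s j≤n)))) ,
      +-monoʳ-≤ 6 (+-cancelʳ-≤ 0 t _ le)

  -- Cost of the left seed procedure.

  module LeftSeeds where

    Bounded : Store → Set
    Bounded σ = (∀ j → 1 ≤ j → j ≤ n → arrays σ P j ≤ n) × (1 ≤ n → arrays σ C n ≤ n)

    bounded : ∀ σ → IsPeriodArray u (arrays σ P) → IsCoverArray u (arrays σ C) → Bounded σ
    bounded σ periods covers =
      (λ j 1≤j j≤n → ≤-trans
        (proj₂ (proj₁ (IsPer⇔ j≤n) (periods j 1≤j j≤n)) j (period-trivial 1≤j ≤-refl)) j≤n) ,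
      λ 1≤n → covered-bounded 1≤n (proj₁ (proj₁ (IsCover⇔ 1≤n ≤-refl) (covers n 1≤n ≤-refl)))

    clear : ∀ σ → Bounded σ → Run (for i from lit 0 to len loop (R [ var i ]≔ lit 0)) σ λ t τ →
      Bounded τ × t ≤ 18 + 11 * n
    clear σ bd =
      let t , τ , run , bd′ , le = for-run 0 3 (λ _ → Bounded) (λ _ → 0)
            (λ k σ _ _ i≡k bd → _ , _ , ⇓arr , i≡k , bd , ≤-refl) σ z≤n bd
      in t , τ , run , bd′ ,
         ≤-trans (+-cancelʳ-≤ 0 t _ le) (≤-reflexive (cong (7 +_) (*-suc 11 n)))

    -- Later writes may overwrite earlier ones, so only the latest is tracked; after the loop it
    -- reads `R (C n) = n`.
    Reach : ℕ → Store → Set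
    Reach k σ = Bounded σ × (∀ m → 1 ≤ m → suc m ≡ k → arrays σ R (arrays σ C m) ≡ m)

    fill : ∀ σ → Bounded σ →
      Run (for i from lit 1 to len loop (R [ C [ var i ] ]≔ var i)) σ λ t τ →
        Reach (suc n) τ × t ≤ 7 + 12 * n
    fill σ bd =
      let t , τ , run , reach , le = for-run 1 4 Reach (λ _ → 0)
            (λ { _ σ _ _ refl (bd , _) → _ , _ , ⇓arr , refl ,
                 (bd , λ { m _ refl → update-same (arrays σ R) (arrays σ C m) m }) , ≤-refl })
            σ (s≤s z≤n) (bd , λ { zero () _ ; (suc m) _ () })
      in t , τ , run , reach , +-cancelʳ-≤ 0 t _ le

    Inv : Store → Set
    Inv σ = Reach (suc n) σ × (1 ≤ n → scalars σ ls ≤ arrays σ C n)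

    -- An increment of `ls` costs 6 for the guard and 3 for the assignment.
    Ψ : Store → ℕ
    Ψ σ = 9 * (n ∸ scalars σ ls)

    Inner : ℕ → Store → Set
    Inner k σ = scalars σ i ≡ k × Inv σ

    advance : ∀ {k} → 1 ≤ k → k ≤ n → ∀ σ → Inner k σ →
      evalT σ (R [ var ls ] ≺ P [ var i ]) ≡ true →
      Run (ls ≔ suc′ (var ls)) σ λ t τ → Inner k τ × 6 + t + Ψ τ ≤ Ψ σ
    advance {k} 1≤k k≤n σ (refl , reach@((P≤n , C≤n) , R≡) , ls≤C) guard =
      _ , _ , ⇓var , (refl , reach , λ _ → ls<C) , (begin
        9 + 9 * (n ∸ suc l) ≡⟨ *-suc 9 (n ∸ suc l) ⟨
        9 * suc (n ∸ suc l) ≤⟨ *-monoʳ-≤ 9 (∸-monoʳ-< ≤-refl (≤-trans ls<C (C≤n 1≤n))) ⟩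
        9 * (n ∸ l)         ∎)
      where
      open ≤-Reasoning
      l = scalars σ ls
      1≤n = ≤-trans 1≤k k≤n
      ls<C : l < arrays σ C n
      -- If `ls` were `C n`, the guard would say `n < P k`, but periods are at most `n`.
      ls<C = ≤∧≢⇒< (ls≤C 1≤n) λ l≡C → <⇒≱
        (<-≤-trans (<ᵇ-true guard) (P≤n k 1≤k k≤n))
        (≤-reflexive (sym (trans (cong (arrays σ R) l≡C) (R≡ n 1≤n refl))))

    body : ∀ k σ → 1 ≤ k → k ≤ n → scalars σ i ≡ k → Inv σ →
      Run ((while R [ var ls ] ≺ P [ var i ] loop (ls ≔ suc′ (var ls))) ︔
           LSeed [ var i ]≔ var ls) σ λ t τ →
        scalars τ i ≡ k × Inv (next τ) × t + Ψ (next τ) ≤ 9 + Ψ σ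
    body k σ 1≤k k≤n i≡k inv
      with while-run (Inner k) Ψ (advance 1≤k k≤n) σ (i≡k , inv)
    ... | t , τ , run , (i≡k′ , inv′) , _ , le =
      _ , _ , ⇓seq run ⇓arr , i≡k′ , inv′ ,
      ≤-trans (≤-reflexive (trans (cong (_+ Ψ τ) (+-comm t 3)) (+-assoc 3 t (Ψ τ)))) (+-monoʳ-≤ 3 le)

    search : ∀ σ → Reach (suc n) σ →
      Run (for i from lit 1 to len loop
        ((while R [ var ls ] ≺ P [ var i ] loop (ls ≔ suc′ (var ls))) ︔
         LSeed [ var i ]≔ var ls)) (setVar σ ls 0) λ t _ → t ≤ 7 + 26 * n
    search σ reach =
      let t , τ , run , _ , le =
            for-run 1 9 (λ _ → Inv) Ψ body (setVar σ ls 0) (s≤s z≤n) (reach , λ _ → z≤n)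
      in t , τ , run , ≤-trans (m+n≤o⇒m≤o t le) (+-monoʳ-≤ 7 (≤-reflexive (sym (*-distribʳ-+ n 17 9))))

    run : ∀ σ → Run (computeLeftSeedArray computePeriods computeCovers) σ λ t _ → t ≤ 59 + 123 * n
    run σ =
      let t₁ , σ₁ , run₁ , periods , le₁ = Periods.run σ
          t₂ , σ₂ , run₂ , periods′ , covers , le₂ = Covers.run σ₁ periods
          t₃ , σ₃ , run₃ , bd , le₃ = clear σ₂ (bounded σ₂ periods′ covers)
          t₄ , σ₄ , run₄ , reach , le₄ = fill σ₃ bd
          t₅ , σ₅ , run₅ , le₅ = search σ₄ reach
      in t₁ + (t₂ + (t₃ + (t₄ + (2 + t₅)))) , σ₅ ,
         ⇓seq run₁ (⇓seq run₂ (⇓seq run₃ (⇓seq run₄ (⇓seq ⇓var run₅)))) ,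
         -- The second pair of constants always sums up the later phases; the innermost 9 is 2 for
         -- resetting `ls` plus 7 from `search`.
         affine-+ 12 45 47 78 n le₁ (affine-+ 13 29 34 49 n le₂
           (affine-+ 18 11 16 38 n le₃ (affine-+ 7 12 9 26 n le₄ (+-monoʳ-≤ 2 le₅))))

theorem2 : ∃₂ λ (computePeriods computeCovers : Cmd) →
    ComputesPeriodArray computePeriods ×
    ComputesCoverArray computeCovers ×
    RunsInLinearTime (computeLeftSeedArray computePeriods computeCovers)
theorem2 = computePeriods , computeCovers ,
  (λ _≟A_ u σ → let t , τ , run , periods , _ = Execution.Periods.run _≟A_ u σ in
    t , τ , run , periods) ,
  (λ _≟A_ u σ periods → let t , τ , run , periods′ , covers , _ = Execution.Covers.run _≟A_ u σ periods in
    t , τ , run , periods′ , covers) ,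
  -- 182 is 59 + 123: for nonempty inputs the constant term is absorbed into the linear one.
  182 , 1 , λ _≟A_ u σ → let t , τ , run , t≤ = Execution.LeftSeeds.run _≟A_ u σ in
    t , τ , run , λ 1≤n → affine⇒linear 59 123 1≤n t≤
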